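{- The Shortest Path under the Deterministic Correlated Model (SPDCM) problem cannot be approximated to arbitrary degree in polynomial time, unless P=NP. That is, unless P=NP, for every approximation ratio $\alpha>1$ there is no polynomial-time algorithm which, given any directed network $G(\mathcal{N},\mathcal{L})$ whose link costs follow the deterministic correlated model, a source $s$ and a destination $t$, returns a path from $s$ to $t$ of cost at most $\alpha\cdot opt$, where $opt$ is the minimum cost of a path from $s$ to $t$ and the cost of a path is the joint total cost of its links.
   Context: A network $G(\mathcal{N},\mathcal{L})$ has a set $\mathcal{N}$ of $N$ nodes and a set $\mathcal{L}$ of $L$ links. Paths are simple (no looping). Deterministic correlated model: each link $l$ has a nonnegative cost $w(l)$. For any $m>1$ distinct links $l_1,\dots,l_m$ the joint total cost is $$w(l_1)\oplus w(l_2)\oplus\cdots\oplus w(l_m)=\rho_{1,2,\dots,m}\cdot\big(w(l_1)+w(l_2)+\cdots+w(l_m)\big),$$ where $\rho_{1,\dots,m}\in(0,\infty)$ is the correlation coefficient of this set of links ($\rho=1$: uncorrelated, $\rho>1$: increasing correlation, $\rho<1$: decreasing correlation). The joint total cost of a single link $l$ is $w(l)$. The cost of a path is the joint total cost of the set of all its links. The costs and the correlations are part of the problem instance, given by a description from which the joint total cost of any given set of links can be computed in polynomial time. SPDCM problem: given a directed network whose link costs follow the deterministic correlated model, a source $s$ and a destination $t$, find a path from $s$ to $t$ of minimum cost. -}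

module Defs where

open import Data.Bool.Base using (Bool; true; false; if_then_else_)
open import Data.Fin.Base using (Fin; zero; suc; toℕ)
open import Data.Fin.Subset using (Subset; inside; outside; ∣_∣; ⋃; ⁅_⁆)
open import Data.Integer.Base as ℤ using ()
open import Data.List.Base as List using (List; []; _∷_)
open import Data.List.Relation.Unary.Unique.Propositional using (Unique)
open import Data.Nat.Base as ℕ using (ℕ; zero; suc)
open import Data.Nat.Binary.Base as ℕᵇ using (ℕᵇ; 2[1+_]; 1+[2_])
open import Data.Nat.Properties using (_<?_)
open import Data.Product.Base using (Σ; ∃; _×_; _,_; proj₁; proj₂)
open import Data.Rational.Base as ℚ using (ℚ; 0ℚ; ↥_; ↧ₙ_)
open import Data.Vec.Base as Vec using (Vec; []; _∷_)
open import Function.Base using (_∘_; id)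
open import Function.Bundles using (_⇔_)
open import Function.Definitions using (Injective)
open import Relation.Binary.PropositionalEquality.Core using (_≡_; _≢_)
open import Relation.Nullary.Decidable.Core using (does)

-- Machine model: the language I of N. D. Jones, "Computability and
-- Complexity from a Programming Perspective" (WHILE with one atom and one
-- variable), with its cost measure up to constant factors.  The only
-- test is "is it nil?" and trees may be shared, so
-- a command can be executed with pointers at constant cost per unit of
-- time, and polynomial time here is polynomial time on Turing machines.

infixr 5 _∙_

data Tree : Set where
  nil : Tree
  _∙_ : Tree → Tree → Tree

size : Tree → ℕ
size nil     = 1
size (a ∙ b) = suc (size a ℕ.+ size b)

hd tl : Tree → Tree
hd nil     = nil
hd (a ∙ _) = a
tl nil     = nil
tl (_ ∙ b) = b

data Exp : Set where
  X    : Exp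
  nilᴱ : Exp
  cons : Exp → Exp → Exp
  hdᴱ  : Exp → Exp
  tlᴱ  : Exp → Exp

infixr 4 _⨾_
infix  5 X:=_
infix  5 while_loop_

data Cmd : Set where
  X:=_        : Exp → Cmd
  _⨾_         : Cmd → Cmd → Cmd
  while_loop_ : Exp → Cmd → Cmd

⟦_⟧ : Exp → Tree → Tree
⟦ X ⟧        x = x
⟦ nilᴱ ⟧     x = nil
⟦ cons e f ⟧ x = ⟦ e ⟧ x ∙ ⟦ f ⟧ x
⟦ hdᴱ e ⟧    x = hd (⟦ e ⟧ x)
⟦ tlᴱ e ⟧    x = tl (⟦ e ⟧ x)

cost : Exp → ℕ
cost X          = 1
cost nilᴱ       = 1
cost (cons e f) = suc (cost e ℕ.+ cost f)
cost (hdᴱ e)    = suc (cost e)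
cost (tlᴱ e)    = suc (cost e)

-- c ⊢ x ⇓ y [ t ]: command c, started with X = x, halts with X = y
-- after time t.

infix 3 _⊢_⇓_[_]

data _⊢_⇓_[_] : Cmd → Tree → Tree → ℕ → Set where
  assign     : ∀ {e x} → X:= e ⊢ x ⇓ ⟦ e ⟧ x [ suc (cost e) ]
  seq        : ∀ {c d x y z s t} →
               c ⊢ x ⇓ y [ s ] → d ⊢ y ⇓ z [ t ] →
               c ⨾ d ⊢ x ⇓ z [ suc (s ℕ.+ t) ]
  whileFalse : ∀ {e c x} → ⟦ e ⟧ x ≡ nil →
               while e loop c ⊢ x ⇓ x [ suc (cost e) ]
  whileTrue  : ∀ {e c x y z s t} → ⟦ e ⟧ x ≢ nil →
               c ⊢ x ⇓ y [ s ] → while e loop c ⊢ y ⇓ z [ t ] →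
               while e loop c ⊢ x ⇓ z [ suc (cost e ℕ.+ s ℕ.+ t) ]

infix 3 _⊢_⇓_within_

_⊢_⇓_within_ : Cmd → Tree → Tree → ℕ → Set
c ⊢ x ⇓ y within b = ∃ λ t → (c ⊢ x ⇓ y [ t ]) × t ℕ.≤ b

encBool : Bool → Tree
encBool false = nil
encBool true  = nil ∙ nil

encList : {A : Set} → (A → Tree) → List A → Tree
encList enc []       = nil
encList enc (x ∷ xs) = enc x ∙ encList enc xs

encUnary : ℕ → Tree
encUnary zero    = nil
encUnary (suc n) = nil ∙ encUnary n

encℕᵇ : ℕᵇ → Tree
encℕᵇ ℕᵇ.zero  = nil
encℕᵇ 2[1+ n ] = encBool false ∙ encℕᵇ n
encℕᵇ 1+[2 n ] = encBool true ∙ encℕᵇ n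

encBinary : ℕ → Tree
encBinary = encℕᵇ ∘ ℕᵇ.fromℕ

-- The sign is dropped: only nonnegative rationals are ever encoded.
encℚ : ℚ → Tree
encℚ q = encBinary ℤ.∣ ↥ q ∣ ∙ encBinary (↧ₙ q)

encExp : Exp → Tree
encExp X          = encUnary 0 ∙ nil
encExp nilᴱ       = encUnary 1 ∙ nil
encExp (cons e f) = encUnary 2 ∙ encExp e ∙ encExp f
encExp (hdᴱ e)    = encUnary 3 ∙ encExp e
encExp (tlᴱ e)    = encUnary 4 ∙ encExp e

encCmd : Cmd → Tree
encCmd (X:= e)        = encUnary 0 ∙ encExp e
encCmd (c ⨾ d)        = encUnary 1 ∙ encCmd c ∙ encCmd d
encCmd (while e loop c) = encUnary 2 ∙ encExp e ∙ encCmd c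

encString : List Bool → Tree
encString = encList encBool

encSubset : ∀ {n} → Subset n → Tree
encSubset S = encString (Vec.toList S)

data Poly : Set where
  var   : Poly
  const : ℕ → Poly
  _⊕_   : Poly → Poly → Poly
  _⊗_   : Poly → Poly → Poly

eval : Poly → ℕ → ℕ
eval var       n = n
eval (const k) n = k
eval (p ⊕ q)   n = eval p n ℕ.+ eval q n
eval (p ⊗ q)   n = eval p n ℕ.* eval q n

PolyTimeComputable : {A B : Set} → (A → Tree) → (B → Tree) → (A → B) → Set
PolyTimeComputable encA encB f =
  Σ Cmd λ c → Σ Poly λ p →
    ∀ a → c ⊢ encA a ⇓ encB (f a) within eval p (size (encA a))

Language : Set₁
Language = List Bool → Set

InP : Language → Set
InP 𝓛 =
  Σ (List Bool → Bool) λ χ →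
    PolyTimeComputable encString encBool χ ×
    (∀ x → 𝓛 x ⇔ χ x ≡ true)

-- A string paired with a potential certificate of length p(|x|).
Certified : Poly → Set
Certified p = Σ (List Bool) λ x → Vec Bool (eval p (List.length x))

encCertified : ∀ {p} → Certified p → Tree
encCertified (x , u) = encString x ∙ encString (Vec.toList u)

InNP : Language → Set
InNP 𝓛 =
  Σ Poly λ p → Σ (Certified p → Bool) λ V →
    PolyTimeComputable (encCertified {p}) encBool V ×
    (∀ x → 𝓛 x ⇔ (∃ λ u → V (x , u) ≡ true))

P≡NP : Set₁
P≡NP = ∀ (𝓛 : Language) → InP 𝓛 ⇔ InNP 𝓛

Σ[_]_ : ∀ {n} → Subset n → (Fin n → ℚ) → ℚ
Σ[ [] ]          w = 0ℚ
Σ[ inside  ∷ S ] w = w zero ℚ.+ Σ[ S ] (w ∘ suc)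
Σ[ outside ∷ S ] w = Σ[ S ] (w ∘ suc)

record Network : Set where
  field
    N L            : ℕ
    ends           : Fin L → Fin N × Fin N
    ends-injective : Injective _≡_ _≡_ ends
    w              : Fin L → ℚ
    w-nonneg       : ∀ l → 0ℚ ℚ.≤ w l
    -- Values of ρ on sets with fewer than two links are never used.
    ρ              : Subset L → ℚ
    ρ-positive     : ∀ S → 1 ℕ.< ∣ S ∣ → 0ℚ ℚ.< ρ S

  src tgt : Fin L → Fin N
  src = proj₁ ∘ ends
  tgt = proj₂ ∘ ends

  encLink : Fin L → Tree
  encLink l = encUnary (toℕ (src l)) ∙ encUnary (toℕ (tgt l)) ∙ encℚ (w l)

  jointCost : Subset L → ℚ
  jointCost S = if does (1 <? ∣ S ∣) then ρ S ℚ.* Σ[ S ] w else Σ[ S ] w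

  data Walk : Fin N → Fin N → Set where
    []   : ∀ {u} → Walk u u
    step : ∀ {u v} (l : Fin L) → src l ≡ u → Walk (tgt l) v → Walk u v

  nodes : ∀ {u v} → Walk u v → List (Fin N)
  nodes {u} []           = u ∷ []
  nodes {u} (step _ _ π) = u ∷ nodes π

  links : ∀ {u v} → Walk u v → List (Fin L)
  links []           = []
  links (step l _ π) = l ∷ links π

  Path : Fin N → Fin N → Set
  Path u v = Σ (Walk u v) λ π → Unique (nodes π)

  linkSet : ∀ {u v} → Path u v → Subset L
  linkSet (π , _) = ⋃ (List.map ⁅_⁆ (links π))

  pathCost : ∀ {u v} → Path u v → ℚ
  pathCost π = jointCost (linkSet π)

  encPath : ∀ {u v} → Path u v → Tree
  encPath (π , _) = encList (encUnary ∘ toℕ) (links π)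

-- The correlations are described by a program together with a time bound
-- sufficient for it to compute ρ on any set of at least two links.  The
-- bound is written in unary in the encoding below, so running the
-- program takes time polynomial in the length of the description; and
-- every other polynomial-time evaluable description can be put in this
-- form.
record Instance : Set where
  field
    network : Network
  open Network network
  field
    s t       : Fin N
    program   : Cmd
    timeBound : ℕ
    computes  : ∀ S → 1 ℕ.< ∣ S ∣ →
                program ⊢ encSubset S ⇓ encℚ (ρ S) within timeBound

encInstance : Instance → Tree
encInstance I =
  encUnary N ∙ encList encLink (List.allFin L) ∙
  encUnary (toℕ s) ∙ encUnary (toℕ t) ∙
  encCmd program ∙ encUnary timeBound
  where
  open Instance I
  open Network network

module _ (I : Instance) where
  open Instance I
  open Network network

  IsOpt : ℚ → Set
  IsOpt opt = (Σ (Path s t) λ π → pathCost π ≡ opt) ×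
              (∀ (π : Path s t) → opt ℚ.≤ pathCost π)

  -- No demand is made when t is unreachable from s (no optimum exists).
  Approximates : ℚ → Tree → Set
  Approximates α out =
    ∀ opt → IsOpt opt →
    Σ (Path s t) λ π → out ≡ encPath π × pathCost π ℚ.≤ α ℚ.* opt

PolyTimeApproximable : ℚ → Set
PolyTimeApproximable α =
  Σ (Instance → Tree) λ f →
    PolyTimeComputable encInstance id f ×
    (∀ I → Approximates I α (f I))

{-# OPTIONS --safe #-}
-- An approximation algorithm decides every language in NP.  Given a verifier
-- V, an input x is turned into a network whose s–t paths are the certificates
-- u for x, in a chain of triangles with two ways through each, and one bypass
-- link of cost K = α + 1.  Since the correlations are an arbitrary program,
-- that program can run V itself: the path of u costs 1 if V accepts (x , u)
-- and K² otherwise.  With an accepted certificate the optimum is 1 and the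
-- bypass is too expensive; without one the optimum is the bypass, and every
-- other path is too expensive.  So the first link of the returned path tells
-- whether x is in the language.

module Submission where

open import Defs
open import Data.Rational.Base using (ℚ; 1ℚ; _<_)
open import Relation.Nullary.Negation.Core using (¬_)
open import Data.Bool.Base using (Bool; true; false; if_then_else_)
open import Data.Bool.Properties using (_≟_; ¬-not; if-float)
open import Data.Fin.Base using (Fin; zero; suc; fromℕ; toℕ; _↑ʳ_)
open import Data.Fin.Properties using (suc-injective; toℕ-fromℕ; toℕ<n)
open import Data.Fin.Subset using (Subset; inside; outside; ∣_∣; ⋃; ⁅_⁆; _∪_; ⊥)
open import Data.Fin.Subset.Properties
  using (∪-identityˡ; ∪-identityʳ; ∣p∣≤∣p∪q∣; ∣⁅x⁆∣≡1; ∣⊥∣≡0; anySubset?)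
open import Data.List.Base as List using (List; []; _∷_; length; _++_; _ʳ++_)
open import Data.List.Properties using (++-identityʳ; length-tabulate; map-∘)
open import Data.List.Relation.Unary.All using (universal; []; _∷_)
open import Data.List.Relation.Unary.All.Properties using (map⁺)
open import Data.List.Relation.Unary.AllPairs using ([]; _∷_)
open import Data.List.Relation.Unary.Unique.Propositional using (Unique)
import Data.List.Relation.Unary.Unique.Propositional.Properties as Unique
open import Data.Nat.Base using (ℕ; zero; suc; _+_; _*_; _≤_; z≤n; s≤s)
open import Data.Nat.Properties
  using (≤-refl; ≤-trans; ≤-reflexive; n≤1+n; m≤m+n; m≤n+m; <⇒≤; _<?_; +-comm; +-assoc; +-suc;
         *-suc; +-identityʳ; +-mono-≤; +-monoˡ-≤; +-monoʳ-≤; *-mono-≤; *-monoˡ-≤; *-monoʳ-≤)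
open import Data.Nat.Tactic.RingSolver using (solve-∀)
open import Data.Product.Base as Product using (Σ; ∃; _×_; _,_; proj₁; proj₂)
open import Data.Rational.Base as ℚ using (0ℚ)
import Data.Rational.Properties as ℚ
open import Data.Vec.Base as Vec using (Vec; []; _∷_)
open import Data.Vec.Properties using (toList-reverse; length-toList; reverse-involutive)
open import Function.Base using (_∘_; id)
open import Function.Bundles using (_⇔_; mk⇔)
open import Function.Construct.Composition using (_⇔-∘_)
open import Function.Definitions using (Injective)
open import Relation.Binary.PropositionalEquality
open import Relation.Nullary.Decidable using (yes; no; dec-true)
open import Relation.Nullary.Negation.Core using (contradiction)
open Network using (Walk; []; step; links; nodes; src; tgt; Path; pathCost; jointCost; encPath)

-- Composing polynomial-time programs

eval-mono : ∀ p {m n} → m ≤ n → eval p m ≤ eval p n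
eval-mono var       m≤n = m≤n
eval-mono (const k) m≤n = ≤-refl
eval-mono (p ⊕ q)   m≤n = +-mono-≤ (eval-mono p m≤n) (eval-mono q m≤n)
eval-mono (p ⊗ q)   m≤n = *-mono-≤ (eval-mono p m≤n) (eval-mono q m≤n)

infixr 9 _⊚_

_⊚_ : Poly → Poly → Poly
var     ⊚ r = r
const k ⊚ r = const k
(p ⊕ q) ⊚ r = (p ⊚ r) ⊕ (q ⊚ r)
(p ⊗ q) ⊚ r = (p ⊚ r) ⊗ (q ⊚ r)

eval-⊚ : ∀ p r n → eval (p ⊚ r) n ≡ eval p (eval r n)
eval-⊚ var       r n = refl
eval-⊚ (const k) r n = refl
eval-⊚ (p ⊕ q)   r n = cong₂ _+_ (eval-⊚ p r n) (eval-⊚ q r n)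
eval-⊚ (p ⊗ q)   r n = cong₂ _*_ (eval-⊚ p r n) (eval-⊚ q r n)

-- For an assumed program, whose running time is bounded in the size of its input tree: bounding
-- that size in `μ` lets the program join the others.
record SizeBounded {A : Set} (μ : A → ℕ) (g : A → Tree) : Set where
  constructor sized
  field
    sizePoly : Poly
    size≤    : ∀ a → size (g a) ≤ eval sizePoly (μ a)

open SizeBounded

within-≤ : ∀ {c x y s t} → s ≤ t → c ⊢ x ⇓ y within s → c ⊢ x ⇓ y within t
within-≤ s≤t (r , run , r≤s) = r , run , ≤-trans r≤s s≤t

infixr 4 _⨾ʷ_

_⨾ʷ_ : ∀ {c d x y z s t} → c ⊢ x ⇓ y within s → d ⊢ y ⇓ z within t →
       c ⨾ d ⊢ x ⇓ z within suc (s + t)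
(_ , run₁ , ≤₁) ⨾ʷ (_ , run₂ , ≤₂) = _ , seq run₁ run₂ , s≤s (+-mono-≤ ≤₁ ≤₂)

assignʷ : ∀ e x → X:= e ⊢ x ⇓ ⟦ e ⟧ x within suc (cost e)
assignʷ e x = _ , assign , ≤-refl

-- The first summand pays for the last test, the one that fails; each of the `n` rounds pays for a
-- test and a body of time `b`.
whileBound : Exp → ℕ → ℕ → ℕ
whileBound e b n = suc (cost e) + n * (suc (cost e) + b)

exit : ∀ {e c x} → ⟦ e ⟧ x ≡ nil → while e loop c ⊢ x ⇓ x within whileBound e 0 0
exit {e} eq = _ , whileFalse eq , m≤m+n (suc (cost e)) 0

iterate : ∀ {e c x y z b n} → ⟦ e ⟧ x ≢ nil → c ⊢ x ⇓ y within b →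
          while e loop c ⊢ y ⇓ z within whileBound e b n →
          while e loop c ⊢ x ⇓ z within whileBound e b (suc n)
iterate {e} {b = b} {n} ≢nil (_ , run₁ , ≤₁) (_ , run₂ , ≤₂) =
  _ , whileTrue ≢nil run₁ run₂ ,
  ≤-trans (s≤s (+-mono-≤ (+-monoʳ-≤ (cost e) ≤₁) ≤₂))
          (≤-reflexive (regroup (cost e) b (n * (suc (cost e) + b))))
  where
  regroup : ∀ k b r → suc (k + b + (suc k + r)) ≡ suc k + (suc k + b + r)
  regroup = solve-∀

onHdᴱ : Exp → Exp
onHdᴱ X          = hdᴱ X
onHdᴱ nilᴱ       = nilᴱ
onHdᴱ (cons e f) = cons (onHdᴱ e) (onHdᴱ f)
onHdᴱ (hdᴱ e)    = hdᴱ (onHdᴱ e)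
onHdᴱ (tlᴱ e)    = tlᴱ (onHdᴱ e)

-- With only one variable, data survive a run of `c` only inside `X`: `c` works on the head while
-- the tail serves as storage.
onHd : Cmd → Cmd
onHd (X:= e)          = X:= cons (onHdᴱ e) (tlᴱ X)
onHd (c ⨾ d)          = onHd c ⨾ onHd d
onHd (while e loop c) = while onHdᴱ e loop onHd c

⟦onHdᴱ⟧ : ∀ e x k → ⟦ onHdᴱ e ⟧ (x ∙ k) ≡ ⟦ e ⟧ x
⟦onHdᴱ⟧ X          x k = refl
⟦onHdᴱ⟧ nilᴱ       x k = refl
⟦onHdᴱ⟧ (cons e f) x k = cong₂ _∙_ (⟦onHdᴱ⟧ e x k) (⟦onHdᴱ⟧ f x k)
⟦onHdᴱ⟧ (hdᴱ e)    x k = cong hd (⟦onHdᴱ⟧ e x k)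
⟦onHdᴱ⟧ (tlᴱ e)    x k = cong tl (⟦onHdᴱ⟧ e x k)

cost-onHdᴱ : ∀ e → cost (onHdᴱ e) ≤ 2 * cost e
cost-onHdᴱ X          = ≤-refl
cost-onHdᴱ nilᴱ       = s≤s z≤n
cost-onHdᴱ (cons e f) = ≤-trans (s≤s (+-mono-≤ (cost-onHdᴱ e) (cost-onHdᴱ f)))
  (≤-trans (n≤1+n _) (≤-reflexive (double (cost e) (cost f))))
  where
  double : ∀ a b → suc (suc (2 * a + 2 * b)) ≡ 2 * suc (a + b)
  double = solve-∀
cost-onHdᴱ (hdᴱ e)    = ≤-trans (s≤s (cost-onHdᴱ e))
  (≤-trans (n≤1+n _) (≤-reflexive (sym (*-suc 2 (cost e)))))
cost-onHdᴱ (tlᴱ e)    = ≤-trans (s≤s (cost-onHdᴱ e))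
  (≤-trans (n≤1+n _) (≤-reflexive (sym (*-suc 2 (cost e)))))

-- Replacing `X` by `hdᴱ X` at most doubles the cost of an expression, and each assignment also
-- rebuilds the pair at constant cost; the factor 4 absorbs both.
onHd-run : ∀ {c x y t} k → c ⊢ x ⇓ y [ t ] → onHd c ⊢ x ∙ k ⇓ y ∙ k within 4 * t
onHd-run {x = x} k (assign {e}) =
  subst (λ y → _ ⊢ _ ⇓ y ∙ k within _) (⟦onHdᴱ⟧ e x k)
    (within-≤ (≤-trans (s≤s (s≤s (+-monoˡ-≤ 2 (cost-onHdᴱ e)))) bound) (assignʷ _ _))
  where
  regroup : ∀ a → suc (suc (2 * a + 2)) + 2 * a ≡ 4 * suc a
  regroup = solve-∀
  bound : suc (suc (2 * cost e + 2)) ≤ 4 * suc (cost e)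
  bound = ≤-trans (m≤m+n _ (2 * cost e)) (≤-reflexive (regroup (cost e)))
onHd-run k (seq {s = s} {t} run₁ run₂) =
  within-≤ (≤-trans (m≤m+n _ 3) (≤-reflexive (regroup s t)))
    (onHd-run k run₁ ⨾ʷ onHd-run k run₂)
  where
  regroup : ∀ s t → suc (4 * s + 4 * t) + 3 ≡ 4 * suc (s + t)
  regroup = solve-∀
onHd-run {x = x} k (whileFalse {e} eq) =
  _ , whileFalse (trans (⟦onHdᴱ⟧ e x k) eq) ,
  ≤-trans (s≤s (cost-onHdᴱ e)) (≤-trans (m≤m+n _ (2 * cost e + 3)) (≤-reflexive (regroup (cost e))))
  where
  regroup : ∀ a → suc (2 * a) + (2 * a + 3) ≡ 4 * suc a
  regroup = solve-∀
onHd-run {x = x} k (whileTrue {e} {s = s} {t} ≢nil run₁ run₂)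
  with onHd-run k run₁ | onHd-run k run₂
... | _ , run₁′ , ≤₁ | _ , run₂′ , ≤₂ =
  _ , whileTrue (≢nil ∘ trans (sym (⟦onHdᴱ⟧ e x k))) run₁′ run₂′ ,
  ≤-trans (s≤s (+-mono-≤ (+-mono-≤ (cost-onHdᴱ e) ≤₁) ≤₂))
    (≤-trans (m≤m+n _ (2 * cost e + 3)) (≤-reflexive (regroup (cost e) s t)))
  where
  regroup : ∀ a s t → suc (2 * a + 4 * s + 4 * t) + (2 * a + 3) ≡ 4 * suc (a + s + t)
  regroup = solve-∀

onHdʷ : ∀ {c x y t} k → c ⊢ x ⇓ y within t → onHd c ⊢ x ∙ k ⇓ y ∙ k within 4 * t
onHdʷ k (_ , run , ≤t) = within-≤ (*-monoʳ-≤ 4 ≤t) (onHd-run k run)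

quoteᴱ : Tree → Exp
quoteᴱ nil     = nilᴱ
quoteᴱ (a ∙ b) = cons (quoteᴱ a) (quoteᴱ b)

⟦quoteᴱ⟧ : ∀ a x → ⟦ quoteᴱ a ⟧ x ≡ a
⟦quoteᴱ⟧ nil     x = refl
⟦quoteᴱ⟧ (a ∙ b) x = cong₂ _∙_ (⟦quoteᴱ⟧ a x) (⟦quoteᴱ⟧ b x)

-- A command that turns g a into h a in time polynomial in μ a, for every a.
-- Measuring by μ, and not by the size of g a, makes such commands compose
-- although outputs of exponential size are possible (trees are shared).
Program : {A : Set} → (A → ℕ) → (A → Tree) → (A → Tree) → Set
Program μ g h = Σ Cmd λ c → Σ Poly λ p → ∀ a → c ⊢ g a ⇓ h a within eval p (μ a)

module _ {A : Set} {μ : A → ℕ} where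

  infixr 5 _⟫_

  _⟫_ : ∀ {g h k} → Program μ g h → Program μ h k → Program μ g k
  (c , p , run₁) ⟫ (d , q , run₂) =
    (c ⨾ d) , const 1 ⊕ (p ⊕ q) , λ a → run₁ a ⨾ʷ run₂ a

  assignment : ∀ {g} e → Program μ g (⟦ e ⟧ ∘ g)
  assignment e = X:= e , const (suc (cost e)) , λ a → assignʷ e _

  resultIs : ∀ {g h k} → (∀ a → h a ≡ k a) → Program μ g h → Program μ g k
  resultIs h≗k (c , p , run) =
    c , p , λ a → subst (λ y → c ⊢ _ ⇓ y within _) (h≗k a) (run a)

  keeping : ∀ {g h} (k : A → Tree) → Program μ g h →
            Program μ (λ a → g a ∙ k a) (λ a → h a ∙ k a)
  keeping k (c , p , run) = onHd c , const 4 ⊗ p , λ a → onHdʷ (k a) (run a)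

  looping : ∀ {g h} e c (b n : Poly) →
            (∀ a → while e loop c ⊢ g a ⇓ h a within whileBound e (eval b (μ a)) (eval n (μ a))) →
            Program μ g h
  looping e c b n run =
    (while e loop c) , const (suc (cost e)) ⊕ (n ⊗ (const (suc (cost e)) ⊕ b)) , run

  -- The language has no conditional. The bit is put in front of the default `a₀`, and a loop
  -- guarded by it runs at most once, as its body clears the bit while it replaces `a₀` by `a₁`.
  select : ∀ (b : A → Bool) a₁ a₀ → Program μ (encBool ∘ b) (λ a → if b a then a₁ else a₀)
  select b a₁ a₀ = assignment (cons X (quoteᴱ a₀)) ⟫ choose ⟫ assignment (tlᴱ X)
    where
    body : Exp
    body = cons nilᴱ (quoteᴱ a₁)

    run : ∀ b x → while hdᴱ X loop X:= body ⊢ encBool b ∙ ⟦ quoteᴱ a₀ ⟧ x ⇓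
          nil ∙ (if b then a₁ else a₀) within whileBound (hdᴱ X) (suc (cost body)) 1
    run true  x = subst
      (λ y → while hdᴱ X loop X:= body ⊢ encBool true ∙ ⟦ quoteᴱ a₀ ⟧ x ⇓ nil ∙ y within _)
      (⟦quoteᴱ⟧ a₁ _) (iterate {n = 0} (λ ()) (assignʷ body _) (exit refl))
    run false x = subst
      (λ y → while hdᴱ X loop X:= body ⊢ nil ∙ ⟦ quoteᴱ a₀ ⟧ x ⇓ nil ∙ y within _)
      (⟦quoteᴱ⟧ a₀ x) (within-≤ (m≤m+n _ _) (exit refl))

    choose : Program μ (λ a → encBool (b a) ∙ ⟦ quoteᴱ a₀ ⟧ (encBool (b a)))
                       (λ a → nil ∙ (if b a then a₁ else a₀))
    choose = looping (hdᴱ X) (X:= body) (const (suc (cost body))) (const 1)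
                     (λ a → run (b a) _)

reindex : ∀ {A B : Set} {μ : A → ℕ} {g h} (f : B → A) →
          Program μ g h → Program (μ ∘ f) (g ∘ f) (h ∘ f)
reindex f (c , p , run) = c , p , run ∘ f

remeasure : ∀ {A : Set} {μ ν : A → ℕ} {g h} q → (∀ a → μ a ≤ eval q (ν a)) →
            Program μ g h → Program ν g h
remeasure {ν = ν} q μ≤ (c , p , run) = c , p ⊚ q , λ a →
  within-≤ (≤-trans (eval-mono p (μ≤ a)) (≤-reflexive (sym (eval-⊚ p q (ν a))))) (run a)

onSized : ∀ {A : Set} {μ : A → ℕ} {g h} → SizeBounded μ g → Program (size ∘ g) g h → Program μ g h
onSized g-bounded = remeasure (sizePoly g-bounded) (size≤ g-bounded)

-- Evaluating polynomials in unary

iterateConsNil : ℕ → Exp → Exp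
iterateConsNil zero    e = e
iterateConsNil (suc k) e = cons nilᴱ (iterateConsNil k e)

⟦iterateConsNil⟧ : ∀ k e x n → ⟦ e ⟧ x ≡ encUnary n → ⟦ iterateConsNil k e ⟧ x ≡ encUnary (n + k)
⟦iterateConsNil⟧ zero    e x n eq = trans eq (cong encUnary (sym (+-identityʳ n)))
⟦iterateConsNil⟧ (suc k) e x n eq =
  trans (cong (nil ∙_) (⟦iterateConsNil⟧ k e x n eq)) (cong encUnary (sym (+-suc n k)))

-- The accumulator `n` turns a sum into two consecutive runs, and `x` is preserved because its
-- length is needed again by every later subterm.
addPoly : ∀ p → Program {List Bool × ℕ} (length ∘ proj₁)
                        (λ (x , n) → encString x ∙ encUnary n)
                        (λ (x , n) → encString x ∙ encUnary (n + eval p (length x)))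
addPoly (const k) =
  resultIs (λ (x , n) → cong (encString x ∙_) (⟦iterateConsNil⟧ k (tlᴱ X) _ n refl))
           (assignment (cons (hdᴱ X) (iterateConsNil k (tlᴱ X))))
addPoly var =
  -- The loop consumes a second copy of `x`, one unit per letter.
  assignment (cons (hdᴱ X) X) ⟫
  looping (hdᴱ X) (X:= body) (const _) var (λ (x , n) → run (encString x) x n) ⟫
  assignment (tlᴱ X)
  where
  body : Exp
  body = cons (tlᴱ (hdᴱ X)) (cons (hdᴱ (tlᴱ X)) (cons nilᴱ (tlᴱ (tlᴱ X))))

  run : ∀ k x n → while hdᴱ X loop X:= body ⊢ encString x ∙ k ∙ encUnary n ⇓
                  nil ∙ k ∙ encUnary (n + length x) within
                  whileBound (hdᴱ X) (suc (cost body)) (length x)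
  run k []      n rewrite +-identityʳ n = exit refl
  run k (b ∷ x) n rewrite +-suc n (length x) =
    iterate {n = length x} (λ ()) (assignʷ _ _) (run k x (suc n))
addPoly (p ⊕ q) =
  resultIs (λ (x , n) → cong (λ j → encString x ∙ encUnary j) (+-assoc n (eval p (length x)) _))
           (addPoly p ⟫ reindex (λ (x , n) → x , n + eval p (length x)) (addPoly q))
addPoly (p ⊗ q) =
  -- The value of `p` is computed from a fresh zero with `n` set aside; it then counts the rounds of
  -- a loop that adds `q` to `n`.
  assignment (cons (cons (hdᴱ X) nilᴱ) (tlᴱ X)) ⟫
  keeping _ (reindex (λ (x , _) → x , 0) (addPoly p)) ⟫
  assignment (cons (cons (hdᴱ (hdᴱ X)) (tlᴱ X)) (tlᴱ (hdᴱ X))) ⟫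
  looping (tlᴱ X) body (const 1 ⊕ ((const 4 ⊗ proj₁ (proj₂ (addPoly q))) ⊕ const _)) p
    (λ (x , n) → run x (eval p (length x)) n) ⟫
  assignment (hdᴱ X)
  where
  countDown : Exp
  countDown = cons (hdᴱ X) (tlᴱ (tlᴱ X))

  body : Cmd
  body = onHd (proj₁ (addPoly q)) ⨾ X:= countDown

  run : ∀ x i n → while tlᴱ X loop body ⊢ (encString x ∙ encUnary n) ∙ encUnary i ⇓
        (encString x ∙ encUnary (n + i * eval q (length x))) ∙ nil within
        whileBound (tlᴱ X)
          (suc (4 * eval (proj₁ (proj₂ (addPoly q))) (length x) + suc (cost countDown))) i
  run x zero    n rewrite +-identityʳ n = exit refl
  run x (suc i) n rewrite sym (+-assoc n (eval q (length x)) (i * eval q (length x))) =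
    iterate {n = i} (λ ())
      (onHdʷ (encUnary (suc i)) (proj₂ (proj₂ (addPoly q)) (x , n)) ⨾ʷ assignʷ countDown _)
      (run x i (n + eval q (length x)))

-- The network of a certificate verifier

module _ (G : Network) where
  open Network G using (N; L)

  -- `step` fixes the next node to be literally `tgt G l`; an embedded link reaches its node only up
  -- to a propositional equality.
  stepTo : ∀ {u v z} (l : Fin L) → src G l ≡ u → tgt G l ≡ v → Walk G v z → Walk G u z
  stepTo l src≡ refl π = step l src≡ π

  links-stepTo : ∀ {u v z} l (src≡ : src G l ≡ u) (tgt≡ : tgt G l ≡ v) (π : Walk G v z) →
                 links G (stepTo l src≡ tgt≡ π) ≡ l ∷ links G π
  links-stepTo l src≡ refl π = refl

  nodes-stepTo : ∀ {u v z} l (src≡ : src G l ≡ u) (tgt≡ : tgt G l ≡ v) (π : Walk G v z) →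
                 nodes G (stepTo l src≡ tgt≡ π) ≡ u ∷ nodes G π
  nodes-stepTo l src≡ refl π = refl

module Embedding (G H : Network)
  (φ : Fin (Network.L G) → Fin (Network.L H)) (ψ : Fin (Network.N G) → Fin (Network.N H))
  (src-φ : ∀ l → src H (φ l) ≡ ψ (src G l)) (tgt-φ : ∀ l → tgt H (φ l) ≡ ψ (tgt G l)) where

  embed : ∀ {u v} → Walk G u v → Walk H (ψ u) (ψ v)
  embed []              = []
  embed (step l refl π) = stepTo H (φ l) (src-φ l) (tgt-φ l) (embed π)

  links-embed : ∀ {u v} (π : Walk G u v) → links H (embed π) ≡ List.map φ (links G π)
  links-embed []              = refl
  links-embed (step l refl π) =
    trans (links-stepTo H (φ l) (src-φ l) (tgt-φ l) (embed π)) (cong (φ l ∷_) (links-embed π))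

  nodes-embed : ∀ {u v} (π : Walk G u v) → nodes H (embed π) ≡ List.map ψ (nodes G π)
  nodes-embed []                  = refl
  nodes-embed {u} (step l refl π) =
    trans (nodes-stepTo H (φ l) (src-φ l) (tgt-φ l) (embed π)) (cong (ψ u ∷_) (nodes-embed π))

linksToSet : ∀ {n} → List (Fin n) → Subset n
linksToSet ls = ⋃ (List.map ⁅_⁆ ls)

linksToSet-suc : ∀ {n} (ls : List (Fin n)) → linksToSet (List.map suc ls) ≡ outside ∷ linksToSet ls
linksToSet-suc []       = refl
linksToSet-suc (l ∷ ls) = cong (⁅ suc l ⁆ ∪_) (linksToSet-suc ls)

linksToSet-suc² : ∀ {n} (ls : List (Fin n)) →
                  linksToSet (List.map (2 ↑ʳ_) ls) ≡ outside ∷ outside ∷ linksToSet ls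
linksToSet-suc² ls = trans (cong linksToSet (map-∘ {g = suc} {f = suc} ls))
  (trans (linksToSet-suc (List.map suc ls)) (cong (outside ∷_) (linksToSet-suc ls)))

linksToSet-suc³ : ∀ {n} (ls : List (Fin n)) →
                  linksToSet (List.map (3 ↑ʳ_) ls) ≡ outside ∷ outside ∷ outside ∷ linksToSet ls
linksToSet-suc³ ls = trans (cong linksToSet (map-∘ {g = suc} {f = 2 ↑ʳ_} ls))
  (trans (linksToSet-suc (List.map (2 ↑ʳ_) ls)) (cong (outside ∷_) (linksToSet-suc² ls)))

-- A chain of m triangles 2i → 2i+2, 2i → 2i+1, 2i+1 → 2i+2 followed by a
-- single link; a path takes the shortcut 2i → 2i+2 iff its i-th bit is true.
chainEnds : ∀ m → Fin (suc (m * 3)) → Fin (suc (suc (m * 2))) × Fin (suc (suc (m * 2)))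
chainEnds zero    zero                = zero , suc zero
chainEnds (suc m) zero                = zero , suc (suc zero)
chainEnds (suc m) (suc zero)          = zero , suc zero
chainEnds (suc m) (suc (suc zero))    = suc zero , suc (suc zero)
chainEnds (suc m) (suc (suc (suc l))) = Product.map (2 ↑ʳ_) (2 ↑ʳ_) (chainEnds m l)

chainEnds-injective : ∀ m → Injective _≡_ _≡_ (chainEnds m)
chainEnds-injective zero    {zero} {zero} _ = refl
chainEnds-injective (suc m) {zero} {zero} _ = refl
chainEnds-injective (suc m) {zero} {suc zero} ()
chainEnds-injective (suc m) {zero} {suc (suc zero)} ()
chainEnds-injective (suc m) {zero} {suc (suc (suc _))} ()
chainEnds-injective (suc m) {suc zero} {zero} ()
chainEnds-injective (suc m) {suc zero} {suc zero} _ = refl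
chainEnds-injective (suc m) {suc zero} {suc (suc zero)} ()
chainEnds-injective (suc m) {suc zero} {suc (suc (suc _))} ()
chainEnds-injective (suc m) {suc (suc zero)} {zero} ()
chainEnds-injective (suc m) {suc (suc zero)} {suc zero} ()
chainEnds-injective (suc m) {suc (suc zero)} {suc (suc zero)} _ = refl
chainEnds-injective (suc m) {suc (suc zero)} {suc (suc (suc _))} ()
chainEnds-injective (suc m) {suc (suc (suc _))} {zero} ()
chainEnds-injective (suc m) {suc (suc (suc _))} {suc zero} ()
chainEnds-injective (suc m) {suc (suc (suc _))} {suc (suc zero)} ()
chainEnds-injective (suc m) {suc (suc (suc l))} {suc (suc (suc l′))} eq =
  cong (3 ↑ʳ_) (chainEnds-injective m
    (cong₂ _,_ (suc-injective (suc-injective (cong proj₁ eq)))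
               (suc-injective (suc-injective (cong proj₂ eq)))))

-- No link leaves the sink, so a path that takes the bypass has no further link.
chain-sink : ∀ m l → proj₁ (chainEnds m l) ≢ fromℕ (suc (m * 2))
chain-sink zero    zero                ()
chain-sink (suc m) zero                ()
chain-sink (suc m) (suc zero)          ()
chain-sink (suc m) (suc (suc zero))    ()
chain-sink (suc m) (suc (suc (suc l))) eq =
  chain-sink m l (suc-injective (suc-injective eq))

chain : ℕ → Network
chain m = record
  { N = _ ; L = _ ; ends = chainEnds m ; ends-injective = chainEnds-injective m
  ; w = λ _ → 0ℚ ; w-nonneg = λ _ → ℚ.≤-refl
  ; ρ = λ _ → 1ℚ ; ρ-positive = λ _ _ → ℚ.positive⁻¹ 1ℚ }

-- The shortcut is the first link of its triangle, so its membership in the set is the bit.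
chainBits : ∀ m → Subset (suc (m * 3)) → Vec Bool m
chainBits zero    _               = []
chainBits (suc m) (b ∷ _ ∷ _ ∷ S) = b ∷ chainBits m S

-- By induction a path of the shorter chain is embedded behind a new triangle. The embedding raises
-- every node by two, so the first two nodes of the triangle are fresh and the path stays simple.
chainPath : ∀ {m} (u : Vec Bool m) → Σ (Path (chain m) zero (fromℕ (suc (m * 2)))) λ π →
            chainBits m (Network.linkSet (chain m) π) ≡ u
chainPath [] = (step zero refl [] , ((λ ()) ∷ []) ∷ [] ∷ []) , refl
chainPath {suc m} (b ∷ u) with chainPath u
... | (π , π-unique) , bits≡u = extend b
  where
  open Embedding (chain m) (chain (suc m)) (3 ↑ʳ_) (2 ↑ʳ_) (λ _ → refl) (λ _ → refl)
  π⁺ = embed π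
  π-set = linksToSet (links (chain m) π)

  π⁺-set : linksToSet (links (chain (suc m)) π⁺) ≡ outside ∷ outside ∷ outside ∷ π-set
  π⁺-set = trans (cong linksToSet (links-embed π)) (linksToSet-suc³ (links (chain m) π))

  unique : Unique (List.map (2 ↑ʳ_) (nodes (chain m) π))
  unique = Unique.map⁺ (suc-injective ∘ suc-injective) π-unique

  extend : ∀ b → Σ (Path (chain (suc m)) zero (fromℕ (suc (suc m * 2)))) λ π →
           chainBits (suc m) (Network.linkSet (chain (suc m)) π) ≡ b ∷ u
  extend true =
    (step zero refl π⁺ ,
     subst (λ ns → Unique (zero ∷ ns)) (sym (nodes-embed π)) (map⁺ (universal (λ _ ()) _) ∷ unique)) ,
    trans (cong (λ S → chainBits (suc m) (⁅ zero ⁆ ∪ S)) π⁺-set)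
          (cong (true ∷_) (trans (cong (chainBits m) (∪-identityˡ π-set)) bits≡u))
  extend false =
    (step (suc zero) refl (step (suc (suc zero)) refl π⁺) ,
     subst (λ ns → Unique (zero ∷ suc zero ∷ ns)) (sym (nodes-embed π))
       (((λ ()) ∷ map⁺ (universal (λ _ ()) _)) ∷ map⁺ (universal (λ _ ()) _) ∷ unique)) ,
    trans (cong (λ S → chainBits (suc m) (⁅ suc zero ⁆ ∪ (⁅ suc (suc zero) ⁆ ∪ S))) π⁺-set)
          (cong (false ∷_) (trans
            (cong (chainBits m) (trans (∪-identityˡ (⊥ ∪ π-set)) (∪-identityˡ π-set))) bits≡u))

Σ-zero : ∀ {n} (S : Subset n) → Σ[ S ] (λ _ → 0ℚ) ≡ 0ℚ
Σ-zero []            = refl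
Σ-zero (inside  ∷ S) = trans (ℚ.+-identityˡ _) (Σ-zero S)
Σ-zero (outside ∷ S) = Σ-zero S

bits : ∀ m → Subset (suc (suc (suc (m * 3)))) → Vec Bool m
bits m S = chainBits m (Vec.tail (Vec.tail S))

-- The chain, entered from the source 0 through link 1 of cost 1, and the
-- bypass 0 of cost K from the source to the sink.  A path through the chain
-- costs 1 if its bits are accepted and K² otherwise.
module Bypassed (K : ℚ) (1≤K : 1ℚ ℚ.≤ K) (m : ℕ) (accepts : Vec Bool m → Bool) where

  0<K : 0ℚ < K
  0<K = ℚ.<-≤-trans (ℚ.positive⁻¹ 1ℚ) 1≤K

  K≤K*K : K ℚ.≤ K ℚ.* K
  K≤K*K = subst (λ q → q ℚ.≤ K ℚ.* K) (ℚ.*-identityʳ K)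
    (ℚ.*-monoˡ-≤-nonNeg K {{ℚ.nonNegative (ℚ.<⇒≤ 0<K)}} 1≤K)

  sink : Fin (3 + m * 2)
  sink = suc (fromℕ (suc (m * 2)))

  ends : Fin (3 + m * 3) → Fin (3 + m * 2) × Fin (3 + m * 2)
  ends zero          = zero , sink
  ends (suc zero)    = zero , suc zero
  ends (suc (suc l)) = Product.map (1 ↑ʳ_) (1 ↑ʳ_) (chainEnds m l)

  ends-injective : Injective _≡_ _≡_ ends
  ends-injective {zero}        {zero}        _  = refl
  ends-injective {zero}        {suc zero}    ()
  ends-injective {zero}        {suc (suc _)} ()
  ends-injective {suc zero}    {zero}        ()
  ends-injective {suc zero}    {suc zero}    _  = refl
  ends-injective {suc zero}    {suc (suc _)} ()
  ends-injective {suc (suc _)} {zero}        ()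
  ends-injective {suc (suc _)} {suc zero}    ()
  ends-injective {suc (suc _)} {suc (suc _)} eq =
    cong (2 ↑ʳ_) (chainEnds-injective m
      (cong₂ _,_ (suc-injective (cong proj₁ eq)) (suc-injective (cong proj₂ eq))))

  weight : Fin (3 + m * 3) → ℚ
  weight zero          = K
  weight (suc zero)    = 1ℚ
  weight (suc (suc _)) = 0ℚ

  weight-nonneg : ∀ l → 0ℚ ℚ.≤ weight l
  weight-nonneg zero          = ℚ.<⇒≤ 0<K
  weight-nonneg (suc zero)    = ℚ.nonNegative⁻¹ 1ℚ
  weight-nonneg (suc (suc _)) = ℚ.≤-refl

  price : Bool → ℚ
  price b = if b then 1ℚ else K ℚ.* K

  1≤price : ∀ b → 1ℚ ℚ.≤ price b
  1≤price true  = ℚ.≤-refl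
  1≤price false = ℚ.≤-trans 1≤K K≤K*K

  -- Defined on every link set, path or not: any set determines a bit vector, hence a verdict.
  ρ : Subset (3 + m * 3) → ℚ
  ρ S = price (accepts (bits m S))

  G : Network
  G = record
    { N = 3 + m * 2 ; L = 3 + m * 3 ; ends = ends ; ends-injective = ends-injective
    ; w = weight ; w-nonneg = weight-nonneg
    ; ρ = ρ ; ρ-positive = λ S _ → ℚ.<-≤-trans (ℚ.positive⁻¹ 1ℚ) (1≤price (accepts (bits m S))) }

  -- A single link is not subject to correlation, so its own weight remains.
  jointCost-bypass : jointCost G ⁅ zero ⁆ ≡ K
  jointCost-bypass rewrite ∣⊥∣≡0 (m * 3) | Σ-zero (⊥ {m * 3}) = ℚ.+-identityʳ K

  jointCost-chain : ∀ S → 1 ≤ ∣ S ∣ → jointCost G (outside ∷ inside ∷ S) ≡ ρ (outside ∷ inside ∷ S)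
  jointCost-chain S 1≤∣S∣ rewrite dec-true (1 <? suc ∣ S ∣) (s≤s 1≤∣S∣) =
    trans (cong (ρ (outside ∷ inside ∷ S) ℚ.*_)
                (trans (cong (1ℚ ℚ.+_) (Σ-zero S)) (ℚ.+-identityʳ 1ℚ)))
          (ℚ.*-identityʳ _)

  -- No link leads back to the source, so a walk that starts elsewhere meets neither the bypass nor
  -- the entrance. The start is a variable with an equation so that the walk can be matched on.
  chainLinks : ∀ {a u v} → a ≡ suc u → (π : Walk G a v) → ∃ λ ls → links G π ≡ List.map (2 ↑ʳ_) ls
  chainLinks _  []                        = [] , refl
  chainLinks () (step zero refl π)
  chainLinks () (step (suc zero) refl π)
  chainLinks _  (step (suc (suc l)) _ π) with chainLinks refl π
  ... | ls , eq = l ∷ ls , cong (suc (suc l) ∷_) eq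

  links-from-sink : ∀ {u v} → u ≡ sink → (π : Walk G u v) → links G π ≡ []
  links-from-sink _  []                       = refl
  links-from-sink () (step zero refl π)
  links-from-sink () (step (suc zero) refl π)
  links-from-sink eq (step (suc (suc l)) refl π) = contradiction (suc-injective eq) (chain-sink m l)

  chainSet : ∀ (ls : List (Fin (suc (m * 3)))) →
             linksToSet (suc zero ∷ List.map (2 ↑ʳ_) ls) ≡ outside ∷ inside ∷ linksToSet ls
  chainSet ls = trans (cong (⁅ suc zero ⁆ ∪_) (linksToSet-suc² ls))
                      (cong (λ S → outside ∷ inside ∷ S) (∪-identityˡ (linksToSet ls)))

  -- The entrance and at least one chain link make two links, so `ρ` applies; the entrance alone has
  -- nonzero weight, namely 1, so the cost is `ρ` itself.
  jointCost-links : ∀ {v} (π : Walk G (suc zero) v) → links G π ≢ [] →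
    jointCost G (linksToSet (suc zero ∷ links G π)) ≡ ρ (linksToSet (suc zero ∷ links G π))
  jointCost-links π ≢[] with links G π | chainLinks refl π
  ... | _ | []     , refl = contradiction refl ≢[]
  ... | _ | l ∷ ls , refl = subst (λ S → jointCost G S ≡ ρ S) (sym (chainSet (l ∷ ls)))
    (jointCost-chain _ (≤-trans (≤-reflexive (sym (∣⁅x⁆∣≡1 l))) (∣p∣≤∣p∪q∣ ⁅ l ⁆ (linksToSet ls))))

  -- The code of link 0 is `encBool false` and that of link 1 is `encBool true`, so the head of an
  -- encoded path is already an encoded truth value.
  data Classified (π : Path G zero sink) : Set where
    bypass   : hd (encPath G π) ≡ encBool false → pathCost G π ≡ K → Classified π
    viaChain : hd (encPath G π) ≡ encBool true → (∃ λ S → pathCost G π ≡ ρ S) → Classified π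

  classify : ∀ π → Classified π
  classify (step zero refl π , _) =
    bypass refl (trans (cong (λ ls → jointCost G (⁅ zero ⁆ ∪ linksToSet ls)) (links-from-sink refl π))
                       (trans (cong (jointCost G) (∪-identityʳ ⁅ zero ⁆)) jointCost-bypass))
  -- The walk cannot end after the entrance, because node 1 is not the sink.
  classify (step (suc zero) refl (step l eq π) , _) =
    viaChain refl (linksToSet (suc zero ∷ l ∷ links G π) , jointCost-links (step l eq π) (λ ()))
  classify (step (suc (suc _)) () π , _)

  bypassPath : Σ (Path G zero sink) λ π → pathCost G π ≡ K
  bypassPath = (step zero refl [] , ((λ ()) ∷ []) ∷ [] ∷ []) ,
    trans (cong (jointCost G) (∪-identityʳ ⁅ zero ⁆)) jointCost-bypass

  acceptedPath : ∀ u → accepts u ≡ true → Σ (Path G zero sink) λ π → pathCost G π ≡ 1ℚ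
  acceptedPath u accepted with chainPath u
  ... | (π , π-unique) , bits≡u =
    (step (suc zero) refl (embed π) ,
     subst (λ ns → Unique (zero ∷ ns)) (sym (nodes-embed π))
       (map⁺ (universal (λ _ ()) _) ∷ Unique.map⁺ suc-injective π-unique)) ,
    trans (jointCost-links (embed π) (nonempty (embed π)))
          (cong price (trans (cong accepts bits≡) accepted))
    where
    open Embedding (chain m) G (2 ↑ʳ_) (1 ↑ʳ_) (λ _ → refl) (λ _ → refl)

    nonempty : (π : Walk G (suc zero) sink) → links G π ≢ []
    nonempty (step _ _ _) ()

    bits≡ : bits m (linksToSet (suc zero ∷ links G (embed π))) ≡ u
    bits≡ = trans (cong (λ ls → bits m (⁅ suc zero ⁆ ∪ linksToSet ls)) (links-embed π))
                  (trans (cong (bits m) (chainSet (links (chain m) π))) bits≡u)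

  module Gap (α : ℚ) (α<K : α < K) (out : Tree)
    (approximates : ∀ opt →
      (Σ (Path G zero sink) λ π → pathCost G π ≡ opt) ×
      (∀ (π : Path G zero sink) → opt ℚ.≤ pathCost G π) →
      Σ (Path G zero sink) λ π → out ≡ encPath G π × pathCost G π ℚ.≤ α ℚ.* opt) where

    Answer : Set
    Answer = ∃ λ b → hd out ≡ encBool b × ((∃ λ u → accepts u ≡ true) ⇔ b ≡ true)

    -- The optimum is 1, and returning the bypass would give `K ≤ α`.
    accepted : ∀ u → accepts u ≡ true → Answer
    accepted u accepts-u with approximates 1ℚ (acceptedPath u accepts-u , 1≤cost)
      where
      1≤cost : ∀ π → 1ℚ ℚ.≤ pathCost G π
      1≤cost π with classify π
      ... | bypass _ cost≡K         = subst (1ℚ ℚ.≤_) (sym cost≡K) 1≤K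
      ... | viaChain _ (S , cost≡ρ) = subst (1ℚ ℚ.≤_) (sym cost≡ρ) (1≤price (accepts (bits m S)))
    ... | π , refl , cost≤α with classify π
    ...   | viaChain hd≡ _  = true , hd≡ , mk⇔ (λ _ → refl) (λ _ → u , accepts-u)
    ...   | bypass _ cost≡K = contradiction
      (ℚ.≤-<-trans (subst (λ q → q ℚ.≤ α ℚ.* 1ℚ) cost≡K cost≤α)
                   (subst (_< K) (sym (ℚ.*-identityʳ α)) α<K))
      (ℚ.<-irrefl refl)

    -- The optimum is `K`, and returning a path through the chain would give `K * K ≤ α * K`, again
    -- against `α < K`.
    rejected : ¬ (∃ λ u → accepts u ≡ true) → Answer
    rejected none with approximates K (bypassPath , K≤cost)
      where
      K≤cost : ∀ π → K ℚ.≤ pathCost G π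
      K≤cost π with classify π
      ... | bypass _ cost≡K         = ℚ.≤-reflexive (sym cost≡K)
      ... | viaChain _ (S , cost≡ρ) =
        subst (K ℚ.≤_) (sym (trans cost≡ρ (cong price (¬-not (none ∘ (bits m S ,_)))))) K≤K*K
    ... | π , refl , cost≤αK with classify π
    ...   | bypass hd≡ _            = false , hd≡ , mk⇔ (λ found → contradiction found none) (λ ())
    ...   | viaChain _ (S , cost≡ρ) = contradiction
      (ℚ.≤-<-trans
        (subst (λ q → q ℚ.≤ α ℚ.* K) (trans cost≡ρ (cong price (¬-not (none ∘ (bits m S ,_))))) cost≤αK)
        (ℚ.*-monoˡ-<-pos K {{ℚ.positive 0<K}} α<K))
      (ℚ.<-irrefl refl)

    -- A `Subset` is a bit vector, so the library's search over subsets ranges over certificates. It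
    -- only separates the cases of the proof; the bit itself is found at the head of `out`.
    answer : Answer
    answer with anySubset? (λ u → accepts u ≟ true)
    ... | yes (u , accepts-u) = accepted u accepts-u
    ... | no none             = rejected none

-- Computing the network

module _ {A : Set} {μ : A → ℕ} where

  bounded-const : ∀ a → SizeBounded μ (λ _ → a)
  bounded-const a = sized (const (size a)) λ _ → ≤-refl

  bounded-∙ : ∀ {g h} → SizeBounded μ g → SizeBounded μ h → SizeBounded μ (λ a → g a ∙ h a)
  bounded-∙ (sized p g≤) (sized q h≤) = sized (const 1 ⊕ (p ⊕ q)) λ a → s≤s (+-mono-≤ (g≤ a) (h≤ a))

size-encUnary : ∀ n → size (encUnary n) ≡ suc (n * 2)
size-encUnary zero    = refl
size-encUnary (suc n) = cong (2 +_) (size-encUnary n)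

size-encList : ∀ {A : Set} (enc : A → Tree) {k} → (∀ x → size (enc x) ≤ k) →
               ∀ xs → size (encList enc xs) ≤ suc (length xs * suc k)
size-encList enc enc≤k []       = ≤-refl
size-encList enc {k} enc≤k (x ∷ xs) =
  s≤s (≤-trans (+-mono-≤ (enc≤k x) (size-encList enc enc≤k xs)) (≤-reflexive (+-suc k _)))

size-encBool : ∀ b → size (encBool b) ≤ 3
size-encBool false = s≤s z≤n
size-encBool true  = ≤-refl

linkTree : ℕ → ℕ → ℚ → Tree
linkTree i j q = encUnary i ∙ encUnary j ∙ encℚ q

linkᴱ : Exp → Exp → ℚ → Exp
linkᴱ e f q = cons e (cons f (quoteᴱ (encℚ q)))

chainTree : ℕ → ℕ → Tree
chainTree zero    k = linkTree k (suc k) 0ℚ ∙ nil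
chainTree (suc m) k =
  linkTree k (suc (suc k)) 0ℚ ∙ linkTree k (suc k) 0ℚ ∙ linkTree (suc k) (suc (suc k)) 0ℚ ∙
  chainTree m (suc (suc k))

-- The offset `k` and the arbitrary `f` carry the induction: the tail of the list describes the
-- shorter chain with its nodes shifted by two.
encList-chain : ∀ {A : Set} (enc : A → Tree) m k (f : Fin (suc (m * 3)) → A) →
  (∀ l → enc (f l) ≡
         linkTree (toℕ (proj₁ (chainEnds m l)) + k) (toℕ (proj₂ (chainEnds m l)) + k) 0ℚ) →
  encList enc (List.tabulate f) ≡ chainTree m k
encList-chain enc zero    k f enc-f = cong (_∙ nil) (enc-f zero)
encList-chain enc (suc m) k f enc-f =
  cong₂ _∙_ (enc-f zero) (cong₂ _∙_ (enc-f (suc zero)) (cong₂ _∙_ (enc-f (suc (suc zero)))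
    (encList-chain enc m (suc (suc k)) (f ∘ (3 ↑ʳ_)) (λ l → trans (enc-f (3 ↑ʳ l))
      (cong₂ (λ i j → linkTree i j 0ℚ) (shift (toℕ (proj₁ (chainEnds m l))))
                                       (shift (toℕ (proj₂ (chainEnds m l)))))))))
  where
  shift : ∀ i → suc (suc (i + k)) ≡ i + suc (suc k)
  shift i = sym (trans (+-suc i (suc k)) (cong suc (+-suc i k)))

module Reduction (p : Poly) (V : Certified p → Bool)
  (verify : PolyTimeComputable (encCertified {p}) encBool V)
  (K : ℚ) (1≤K : 1ℚ ℚ.≤ K) where

  m : List Bool → ℕ
  m x = eval p (length x)

  LinkSet : List Bool → Set
  LinkSet x = Subset (3 + m x * 3)

  -- The loop that reads the bits off a link set stacks them in reverse order, so the network tests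
  -- reversed certificates.
  module Net x = Bypassed K 1≤K (m x) (λ u → V (x , Vec.reverse u))

  certified : Σ (List Bool) LinkSet → Certified p
  certified (x , S) = x , Vec.reverse (bits (m x) S)

  bounded-certified : ∀ {A : Set} (f : A → Certified p) →
                      SizeBounded (length ∘ proj₁ ∘ f) (encCertified {p} ∘ f)
  bounded-certified f =
    bounded-∙ (sized (const 1 ⊕ (var ⊗ const 4)) λ a → size-encList encBool size-encBool (proj₁ (f a)))
              (sized (const 1 ⊕ (p ⊗ const 4)) λ a →
                 ≤-trans (size-encList encBool size-encBool (Vec.toList (proj₂ (f a))))
                         (≤-reflexive (cong (λ n → suc (n * 4)) (length-toList (proj₂ (f a))))))

  rest : ∀ m → Subset (suc (m * 3)) → Tree
  rest zero    S               = encSubset S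
  rest (suc m) (_ ∷ _ ∷ _ ∷ S) = rest m S

  extractBits : Program (length ∘ proj₁)
    (λ (x , S) → nil ∙ encString x ∙ encSubset (Vec.tail (Vec.tail S)))
    (λ (x , S) → encString (Vec.toList (Vec.reverse (bits (m x) S))) ∙
                 encString x ∙ rest (m x) (Vec.tail (Vec.tail S)))
  extractBits = resultIs
    (λ (x , S) → cong (λ u → encString u ∙ encString x ∙ rest (m x) (Vec.tail (Vec.tail S)))
                      (sym (toList-reverse (bits (m x) S))))
    -- The test looks one bit ahead: it fails when only the bit of the final single link remains.
    (looping (tlᴱ (tlᴱ (tlᴱ X))) (X:= body) (const _) p
             (λ (x , S) → run (m x) (encString x) (Vec.tail (Vec.tail S)) []))
    where
    body : Exp
    body = cons (cons (hdᴱ (tlᴱ (tlᴱ X))) (hdᴱ X))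
                (cons (hdᴱ (tlᴱ X)) (tlᴱ (tlᴱ (tlᴱ (tlᴱ (tlᴱ X))))))

    run : ∀ m k (S : Subset (suc (m * 3))) acc →
          while tlᴱ (tlᴱ (tlᴱ X)) loop X:= body ⊢ encString acc ∙ k ∙ encSubset S ⇓
          encString (Vec.toList (chainBits m S) ʳ++ acc) ∙ k ∙ rest m S within
          whileBound (tlᴱ (tlᴱ (tlᴱ X))) (suc (cost body)) m
    run zero    k (_ ∷ [])        acc = exit refl
    run (suc m) k (b ∷ _ ∷ _ ∷ S) acc =
      iterate {n = m} (λ ()) (assignʷ body _) (run m k S (b ∷ acc))

  -- Computes the correlation: drop the bits of bypass and entrance, collect the certificate, run
  -- the verifier, turn its verdict into a price.
  evaluator : Program (length ∘ proj₁) (λ (x , S) → encString x ∙ encSubset S)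
                                       (λ (x , S) → encℚ (Net.ρ x S))
  evaluator =
    resultIs (λ { (x , _ ∷ _ ∷ _) → refl })
      (assignment (cons nilᴱ (cons (hdᴱ X) (tlᴱ (tlᴱ (tlᴱ X)))))) ⟫
    extractBits ⟫
    assignment (cons (hdᴱ (tlᴱ X)) (hdᴱ X)) ⟫
    onSized (bounded-certified certified) (reindex certified verify) ⟫
    resultIs (λ (x , S) → sym (if-float encℚ (V (x , Vec.reverse (bits (m x) S)))))
      (select (V ∘ certified) (encℚ 1ℚ) (encℚ (K ℚ.* K)))

  -- hdᴱ and tlᴱ are coded by the numbers 3 and 4, so the code of this
  -- expression is obtained from encBool b without a case distinction.
  bitᴱ : Bool → Exp
  bitᴱ false = hdᴱ (cons nilᴱ (cons nilᴱ nilᴱ))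
  bitᴱ true  = tlᴱ (cons nilᴱ (cons nilᴱ nilᴱ))

  push : Bool → Cmd
  push b = X:= cons (cons (bitᴱ b) (hdᴱ X)) (tlᴱ X)

  pushCost : ℕ
  pushCost = suc (cost (cons (cons (bitᴱ true) (hdᴱ X)) (tlᴱ X)))

  pushʷ : ∀ b x k → push b ⊢ encString x ∙ k ⇓ encString (b ∷ x) ∙ k within pushCost
  pushʷ false x k = assignʷ _ _
  pushʷ true  x k = assignʷ _ _

  -- The last bit of x is pushed first, so a single pass over x that prepends
  -- code, with no reversal, yields a command that rebuilds x in order.
  load : List Bool → Cmd → Cmd
  load []      c = c
  load (b ∷ x) c = load x (push b ⨾ c)

  loadʷ : ∀ x {y k z c t} → c ⊢ encString (x ++ y) ∙ k ⇓ z within t →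
          load x c ⊢ encString y ∙ k ⇓ z within length x * suc pushCost + t
  loadʷ []      run = run
  loadʷ (b ∷ x) {y} {k} {t = t} run =
    within-≤ (≤-reflexive (regroup (length x * suc pushCost) (suc pushCost) t))
             (loadʷ x (pushʷ b (x ++ y) k ⨾ʷ run))
    where
    regroup : ∀ a b c → a + (b + c) ≡ b + a + c
    regroup = solve-∀

  init : Cmd
  init = X:= cons nilᴱ X

  program : List Bool → Cmd
  program x = init ⨾ load x (proj₁ evaluator)

  -- The 4 is the time of `init`, the 1 that of the sequencing; each letter of `x` costs one push
  -- and one sequencing.
  Q : Poly
  Q = const 1 ⊕ (const 4 ⊕ ((var ⊗ const (suc pushCost)) ⊕ proj₁ (proj₂ evaluator)))

  programʷ : ∀ x (S : LinkSet x) → program x ⊢ encSubset S ⇓ encℚ (Net.ρ x S) within eval Q (length x)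
  programʷ x S = assignʷ _ _ ⨾ʷ loadʷ x {y = []}
    (subst (λ y → proj₁ evaluator ⊢ encString y ∙ encSubset S ⇓ encℚ (Net.ρ x S) within
                eval (proj₁ (proj₂ evaluator)) (length x)) (sym (++-identityʳ x))
      (proj₂ (proj₂ evaluator) (x , S)))

  inst : List Bool → Instance
  inst x = record
    { network = Net.G x ; s = zero ; t = Net.sink x
    ; program = program x ; timeBound = eval Q (length x)
    ; computes = λ S _ → programʷ x S }

  pushCodeᴱ : Exp → Exp → Exp
  pushCodeᴱ b c =
    cons (quoteᴱ (encUnary 1)) (cons (cons nilᴱ (cons (quoteᴱ (encUnary 2)) (cons
      (cons (quoteᴱ (encUnary 2)) (cons
        -- Three `nil`s in front of an encoded bit give the number 3 or 4, the tag of `hdᴱ` or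
        -- `tlᴱ`.
        (cons (cons nilᴱ (cons nilᴱ (cons nilᴱ b))) (quoteᴱ (encExp (cons nilᴱ (cons nilᴱ nilᴱ)))))
        (quoteᴱ (encExp (hdᴱ X)))))
      (quoteᴱ (encExp (tlᴱ X)))))) c)

  loadCode : ∀ (k : List Bool → Tree) → Program length
    (λ x → (encString x ∙ encCmd (proj₁ evaluator)) ∙ k x)
    (λ x → (nil ∙ encCmd (load x (proj₁ evaluator))) ∙ k x)
  loadCode k = looping (hdᴱ (hdᴱ X)) (X:= body) (const _) var (λ x → run x (proj₁ evaluator) (k x))
    where
    body : Exp
    body = cons (cons (tlᴱ (hdᴱ (hdᴱ X))) (pushCodeᴱ (hdᴱ (hdᴱ (hdᴱ X))) (tlᴱ (hdᴱ X)))) (tlᴱ X)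

    run : ∀ x c k → while hdᴱ (hdᴱ X) loop X:= body ⊢ (encString x ∙ encCmd c) ∙ k ⇓
          (nil ∙ encCmd (load x c)) ∙ k within whileBound (hdᴱ (hdᴱ X)) (suc (cost body)) (length x)
    run []          c k = exit refl
    run (false ∷ x) c k = iterate {n = length x} (λ ()) (assignʷ body _) (run x (push false ⨾ c) k)
    run (true ∷ x)  c k = iterate {n = length x} (λ ()) (assignʷ body _) (run x (push true ⨾ c) k)

  -- The list is built from the sink backwards, each round prepending a triangle. The node index
  -- falls by two per round and doubles as the loop counter, stopping at 1, where the chain begins.
  buildChain : ∀ (k : List Bool → Tree) → Program length
    (λ x → (encUnary (suc (m x * 2)) ∙ chainTree 0 (suc (m x * 2))) ∙ k x)
    (λ x → (encUnary 1 ∙ chainTree (m x) 1) ∙ k x)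
  buildChain k = looping (tlᴱ i) (X:= body) (const _) p (λ x → run (m x) 0 (k x))
    where
    i : Exp
    i = hdᴱ (hdᴱ X)

    body : Exp
    body = cons (cons (tlᴱ (tlᴱ i))
      (cons (linkᴱ (tlᴱ (tlᴱ i)) i 0ℚ) (cons (linkᴱ (tlᴱ (tlᴱ i)) (tlᴱ i) 0ℚ)
      (cons (linkᴱ (tlᴱ i) i 0ℚ) (tlᴱ (hdᴱ X)))))) (tlᴱ X)

    run : ∀ n j k →
          while tlᴱ i loop X:= body ⊢ (encUnary (suc (n * 2)) ∙ chainTree j (suc (n * 2))) ∙ k ⇓
          (encUnary 1 ∙ chainTree (j + n) 1) ∙ k within whileBound (tlᴱ i) (suc (cost body)) n
    run zero    j k rewrite +-identityʳ j = exit refl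
    run (suc n) j k rewrite +-suc j n =
      iterate {n = n} (λ ()) (assignʷ body _) (run n (suc j) k)

  encode : List Bool → Tree → Tree → Tree
  encode x bypass code =
    encUnary (3 + m x * 2) ∙
    (bypass ∙ linkTree 0 1 1ℚ ∙ chainTree (m x) 1) ∙
    nil ∙ encUnary (2 + m x * 2) ∙ (encUnary 1 ∙ encCmd init ∙ code) ∙
    encUnary (eval Q (length x))

  encode≡ : ∀ x → encode x (linkTree 0 (2 + m x * 2) K) (encCmd (load x (proj₁ evaluator))) ≡
                  encInstance (inst x)
  encode≡ x = cong₂ (λ links sink → encUnary (3 + m x * 2) ∙ links ∙ nil ∙ sink ∙
                                    encCmd (program x) ∙ encUnary (eval Q (length x)))
    (cong₂ (λ t chain → linkTree 0 t K ∙ linkTree 0 1 1ℚ ∙ chain) sink≡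
      (sym (encList-chain (Network.encLink (Net.G x)) (m x) 1 (2 ↑ʳ_)
        (λ l → cong₂ (λ i j → linkTree i j 0ℚ) (+-comm 1 (toℕ (proj₁ (chainEnds (m x) l))))
                                               (+-comm 1 (toℕ (proj₂ (chainEnds (m x) l))))))))
    (cong encUnary sink≡)
    where
    sink≡ : 2 + m x * 2 ≡ toℕ (Net.sink x)
    sink≡ = cong suc (sym (toℕ-fromℕ (suc (m x * 2))))

  -- X runs through x, x ∙ T, (x ∙ N) ∙ x ∙ T, (x ∙ code) ∙ N ∙ T and
  -- (index ∙ links) ∙ N ∙ code ∙ T, where N is the number of nodes and T the
  -- time bound, both in unary.
  reduction : Program length encString (encInstance ∘ inst)
  reduction =
    assignment (cons X nilᴱ) ⟫
    reindex (_, 0) (addPoly Q) ⟫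
    assignment (cons (cons (hdᴱ X) nilᴱ) X) ⟫
    keeping (λ x → encString x ∙ encUnary (eval Q (length x)))
            (reindex (_, 0) (addPoly (const 3 ⊕ (p ⊗ const 2)))) ⟫
    resultIs (λ x → cong (λ c → (encString x ∙ c) ∙
                                encUnary (3 + m x * 2) ∙ encUnary (eval Q (length x)))
                         (⟦quoteᴱ⟧ (encCmd (proj₁ evaluator)) _))
      (assignment (cons (cons (hdᴱ (tlᴱ X)) (quoteᴱ (encCmd (proj₁ evaluator))))
                        (cons (tlᴱ (hdᴱ X)) (tlᴱ (tlᴱ X))))) ⟫
    loadCode _ ⟫
    -- With `N = 3 + m x * 2` nodes the last chain link runs from `N - 2` to the sink `N - 1`.
    assignment (cons (cons (tlᴱ (tlᴱ n)) (cons (linkᴱ (tlᴱ (tlᴱ n)) (tlᴱ n) 0ℚ) nilᴱ))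
                     (cons n (cons (tlᴱ (hdᴱ X)) (tlᴱ (tlᴱ X))))) ⟫
    buildChain _ ⟫
    resultIs (λ x → trans (cong (λ q → encode x (nil ∙ encUnary (2 + m x * 2) ∙ q)
                                                (encCmd (load x (proj₁ evaluator))))
                                (⟦quoteᴱ⟧ (encℚ K) _))
                          (encode≡ x))
      (assignment (cons n (cons
        (cons (linkᴱ nilᴱ (tlᴱ n) K) (cons (linkᴱ nilᴱ (cons nilᴱ nilᴱ) 1ℚ) (tlᴱ (hdᴱ X))))
        (cons nilᴱ (cons (tlᴱ n) (cons
          (cons (quoteᴱ (encUnary 1)) (cons (quoteᴱ (encCmd init)) (hdᴱ (tlᴱ (tlᴱ X)))))
          (tlᴱ (tlᴱ (tlᴱ X)))))))))
    where
    n : Exp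
    n = hdᴱ (tlᴱ X)

  -- Size of the encoded instance

  bounded-unary : ∀ q → SizeBounded {List Bool} length (λ x → encUnary (eval q (length x)))
  bounded-unary q = sized (const 1 ⊕ (q ⊗ const 2)) λ x → ≤-reflexive (size-encUnary (eval q (length x)))

  -- The 5 counts the tag of the sequencing and two pairs; `push true` has the larger code, its tag
  -- being one unit longer.
  codeSize : ℕ
  codeSize = 5 + size (encCmd (push true))

  size-load : ∀ x c → size (encCmd (load x c)) ≤ length x * codeSize + size (encCmd c)
  size-load []      c = ≤-refl
  size-load (b ∷ x) c = ≤-trans (size-load x (push b ⨾ c))
    (≤-trans (+-monoʳ-≤ (length x * codeSize) (pushed b))
             (≤-reflexive (regroup (length x * codeSize) codeSize (size (encCmd c)))))
    where
    regroup : ∀ a k c → a + (k + c) ≡ k + a + c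
    regroup = solve-∀

    pushed : ∀ b → size (encCmd (push b ⨾ c)) ≤ codeSize + size (encCmd c)
    pushed false = m≤n+m _ 2
    pushed true  = ≤-refl

  linkSize : Poly
  linkSize = const 1 ⊕ (nodeSize ⊕ (const 1 ⊕ (nodeSize ⊕ const (size (encℚ K) + size (encℚ 1ℚ)))))
    where
    nodeSize : Poly
    nodeSize = const 1 ⊕ ((const 3 ⊕ (p ⊗ const 2)) ⊗ const 2)

  size-encLink : ∀ x l → size (Network.encLink (Net.G x) l) ≤ eval linkSize (length x)
  size-encLink x l = s≤s (+-mono-≤ (size-node (Network.src (Net.G x) l))
                    (s≤s (+-mono-≤ (size-node (Network.tgt (Net.G x) l)) (size-weight l))))
    where
    size-node : ∀ (v : Fin (3 + m x * 2)) → size (encUnary (toℕ v)) ≤ suc ((3 + m x * 2) * 2)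
    size-node v = ≤-trans (≤-reflexive (size-encUnary (toℕ v))) (s≤s (*-monoˡ-≤ 2 (<⇒≤ (toℕ<n v))))

    size-weight : ∀ l → size (encℚ (Net.weight x l)) ≤ size (encℚ K) + size (encℚ 1ℚ)
    size-weight zero          = m≤m+n _ (size (encℚ 1ℚ))
    size-weight (suc zero)    = m≤n+m (size (encℚ 1ℚ)) (size (encℚ K))
    size-weight (suc (suc _)) =
      -- The numerator 1 instead of 0 makes `encℚ 1ℚ` larger than `encℚ 0ℚ` by 4.
      ≤-trans (m≤m+n (size (encℚ 0ℚ)) 4) (m≤n+m (size (encℚ 1ℚ)) (size (encℚ K)))

  bounded-inst : SizeBounded length (encInstance ∘ inst)
  bounded-inst =
    bounded-∙ (bounded-unary (const 3 ⊕ (p ⊗ const 2))) (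
    bounded-∙ links-bounded (
    bounded-∙ (bounded-const nil) (
    bounded-∙ sink-bounded (
    bounded-∙ (bounded-∙ (bounded-const (encUnary 1))
                         (bounded-∙ (bounded-const (encCmd init)) load-bounded))
              (bounded-unary Q)))))
    where
    sink-bounded : SizeBounded length (λ x → encUnary (toℕ (Net.sink x)))
    sink-bounded = sized (const 1 ⊕ ((const 2 ⊕ (p ⊗ const 2)) ⊗ const 2)) λ x →
      ≤-reflexive (trans (size-encUnary (toℕ (Net.sink x)))
                         (cong (λ n → suc (suc n * 2)) (toℕ-fromℕ (suc (m x * 2)))))

    links-bounded : SizeBounded length
      (λ x → encList (Network.encLink (Net.G x)) (List.allFin (3 + m x * 3)))
    links-bounded = sized (const 1 ⊕ ((const 3 ⊕ (p ⊗ const 3)) ⊗ (const 1 ⊕ linkSize))) λ x →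
      ≤-trans (size-encList (Network.encLink (Net.G x)) (size-encLink x) (List.allFin (3 + m x * 3)))
              (≤-reflexive (cong (λ n → suc (n * suc (eval linkSize (length x))))
                                 (length-tabulate {n = 3 + m x * 3} id)))

    load-bounded : SizeBounded length (λ x → encCmd (load x (proj₁ evaluator)))
    load-bounded =
      sized ((var ⊗ const codeSize) ⊕ const (size (encCmd (proj₁ evaluator))))
            λ x → size-load x (proj₁ evaluator)

  -- The algorithm builds the instance, runs the approximation on it and returns the head of the
  -- result.
  decides : ∀ {α} → α < K → PolyTimeApproximable α →
            Σ (List Bool → Bool) λ χ → PolyTimeComputable encString encBool χ ×
            (∀ x → (∃ λ u → V (x , u) ≡ true) ⇔ χ x ≡ true)
  decides {α} α<K (f , approximate , f-approximates) =
    (λ x → proj₁ (answer x)) ,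
    remeasure var length≤size
      (resultIs (λ x → proj₁ (proj₂ (answer x)))
        (reduction ⟫ onSized bounded-inst (reindex inst approximate) ⟫ assignment (hdᴱ X))) ,
    -- Reversal is an involution, so reversed certificates exist exactly when certificates do.
    (λ x → proj₂ (proj₂ (answer x)) ⇔-∘ mk⇔
      (λ (u , accepted) → Vec.reverse u ,
        trans (cong (λ v → V (x , v)) (reverse-involutive u)) accepted)
      (λ (u , accepted) → Vec.reverse u , accepted))
    where
    answer : ∀ x → Net.Gap.Answer x α α<K (f (inst x)) (f-approximates (inst x))
    answer x = Net.Gap.answer x α α<K (f (inst x)) (f-approximates (inst x))

    length≤size : ∀ x → length x ≤ size (encString x)
    length≤size []      = z≤n
    length≤size (b ∷ x) = s≤s (≤-trans (length≤size x) (m≤n+m _ (size (encBool b))))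

-- From approximability to P = NP

InP⇒InNP : ∀ {𝓛} → InP 𝓛 → InNP 𝓛
InP⇒InNP (χ , compute , correct) =
  -- The only certificate is the empty string, and the verifier ignores it.
  const 0 , (λ (x , _) → χ x) ,
  assignment (hdᴱ X) ⟫
    remeasure var (λ (x , _) → ≤-trans (m≤m+n _ _) (n≤1+n _))
              (reindex {μ = size ∘ encString} proj₁ compute) ,
  λ x → mk⇔ ([] ,_) proj₂ ⇔-∘ correct x

approximable⇒P≡NP : ∀ α → 1ℚ < α → PolyTimeApproximable α → P≡NP
approximable⇒P≡NP α 1<α approximable 𝓛 = mk⇔ InP⇒InNP λ (p , V , verify , correct) →
  let χ , compute , decided =
        -- `K` must be a constant, above `α` for the gap and at least 1 for the optima; `α + 1` is
        -- both, by `1ℚ < α`.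
        Reduction.decides p V verify (α ℚ.+ 1ℚ) (ℚ.<⇒≤ (ℚ.<-trans 1<α α<α+1)) α<α+1 approximable
  in χ , compute , λ x → decided x ⇔-∘ correct x
  where
  α<α+1 : α < α ℚ.+ 1ℚ
  α<α+1 = subst (_< α ℚ.+ 1ℚ) (ℚ.+-identityʳ α) (ℚ.+-monoʳ-< α (ℚ.positive⁻¹ 1ℚ))

theorem2 : ¬ P≡NP → ∀ (α : ℚ) → 1ℚ < α → ¬ PolyTimeApproximable α
theorem2 P≢NP α 1<α approximable = P≢NP (approximable⇒P≡NP α 1<α approximable)
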